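{- For all $n\in\mathbb N=\{0,1,2,\dots\}$ and all integers $d\geq 1$, the rational fraction $$S_{n,d}=\sum_{k=0}^nU_{d-1}\circ T_{(d+1)^k}\prod_{j=0}^k\frac{1}{U_d\circ T_{(d+1)^j}}\in\mathbb Q(x)$$ satisfies the identity $$S_{n,d}^2-2xS_{n,d}+1=\left(\prod_{j=0}^n\frac{1}{U_d\circ T_{(d+1)^j}}\right)^2.$$
   Context: $T_n=T_n(x)$ and $U_n=U_n(x)$ denote the Chebyshev polynomials of the first and second kind, defined by $T_0=1$, $T_1=x$, $T_{n+1}=2xT_n-T_{n-1}$ and $U_0=1$, $U_1=2x$, $U_{n+1}=2xU_n-U_{n-1}$ for $n\geq1$. The symbol $\circ$ denotes composition of polynomials, so $U_{d}\circ T_m$ is $U_d(T_m(x))$. -}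

module Defs where

open import Algebra.Bundles.Raw using (RawRing)
import Algebra.Definitions.RawSemiring as RawSemiringDefinitions
open import Data.Fin.Base using (toℕ)
open import Data.List.Base using (List; []; _∷_; map)
open import Data.Nat.Base as ℕ using (ℕ; zero; suc)
open import Data.Rational.Base as ℚ using (ℚ; 0ℚ; 1ℚ)
import Data.Rational.Properties as ℚ
open import Data.Rational.Solver using (module +-*-Solver)
open import Data.Sum.Base as Sum using (_⊎_; inj₁; inj₂; [_,_]′)
open import Function.Base using (_∘_)
open import Level using (0ℓ)
open import Relation.Binary.PropositionalEquality
open import Relation.Nullary using (¬_; yes; no)

open +-*-Solver

------------------------------------------------------------------------
-- Polynomials over ℚ

-- a₀ ∷ a₁ ∷ … stands for a₀ + a₁ x + …; trailing zeros are allowed, so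
-- that equality of polynomials is _≈ₚ_ rather than _≡_.

ℚ[x] : Set
ℚ[x] = List ℚ

coeff : ℚ[x] → ℕ → ℚ
coeff []      _       = 0ℚ
coeff (a ∷ p) zero    = a
coeff (a ∷ p) (suc i) = coeff p i

infix  4 _≈ₚ_ _≉ₚ_
infixl 6 _+ₚ_ _-ₚ_
infixl 7 _*ₚ_ _·ₚ_
infix  8 -ₚ_
infixr 9 _∘ₚ_

record _≈ₚ_ (p q : ℚ[x]) : Set where
  constructor coeffwise
  field coeff-≡ : ∀ i → coeff p i ≡ coeff q i

open _≈ₚ_ public

_≉ₚ_ : ℚ[x] → ℚ[x] → Set
p ≉ₚ q = ¬ p ≈ₚ q

const : ℚ → ℚ[x]
const a = a ∷ []

0ₚ 1ₚ X 2X : ℚ[x]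
0ₚ = []
1ₚ = const 1ℚ
X  = 0ℚ ∷ 1ℚ ∷ []

_+ₚ_ : ℚ[x] → ℚ[x] → ℚ[x]
[]      +ₚ q       = q
(a ∷ p) +ₚ []      = a ∷ p
(a ∷ p) +ₚ (b ∷ q) = (a ℚ.+ b) ∷ (p +ₚ q)

_·ₚ_ : ℚ → ℚ[x] → ℚ[x]
a ·ₚ p = map (a ℚ.*_) p

-ₚ_ : ℚ[x] → ℚ[x]
-ₚ_ = map (ℚ.-_)

_-ₚ_ : ℚ[x] → ℚ[x] → ℚ[x]
p -ₚ q = p +ₚ -ₚ q

_*ₚ_ : ℚ[x] → ℚ[x] → ℚ[x]
[]      *ₚ q = []
(a ∷ p) *ₚ q = a ·ₚ q +ₚ (0ℚ ∷ p *ₚ q)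

_∘ₚ_ : ℚ[x] → ℚ[x] → ℚ[x]
[]      ∘ₚ q = []
(a ∷ p) ∘ₚ q = const a +ₚ q *ₚ (p ∘ₚ q)

2X = (1ℚ ℚ.+ 1ℚ) ·ₚ X

------------------------------------------------------------------------
-- Chebyshev polynomials

T : ℕ → ℚ[x]
T zero          = 1ₚ
T (suc zero)    = X
T (suc (suc n)) = 2X *ₚ T (suc n) -ₚ T n

U : ℕ → ℚ[x]
U zero          = 1ₚ
U (suc zero)    = 2X
U (suc (suc n)) = 2X *ₚ U (suc n) -ₚ U n

------------------------------------------------------------------------
-- ℚ[x] is an integral domain

private
  p*q≡0⇒q≡0 : ∀ a b → a ≢ 0ℚ → a ℚ.* b ≡ 0ℚ → b ≡ 0ℚ
  p*q≡0⇒q≡0 a b a≢0 ab≡0 = begin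
    b                      ≡⟨ ℚ.*-identityˡ b ⟨
    1ℚ ℚ.* b               ≡⟨ cong (ℚ._* b) (ℚ.*-inverseˡ a) ⟨
    (ℚ.1/ a) ℚ.* a ℚ.* b   ≡⟨ ℚ.*-assoc (ℚ.1/ a) a b ⟩
    (ℚ.1/ a) ℚ.* (a ℚ.* b) ≡⟨ cong ((ℚ.1/ a) ℚ.*_) ab≡0 ⟩
    (ℚ.1/ a) ℚ.* 0ℚ        ≡⟨ ℚ.*-zeroʳ (ℚ.1/ a) ⟩
    0ℚ                     ∎
    where
    open ≡-Reasoning
    instance _ = ℚ.≢-nonZero a≢0

coeff-+ : ∀ p q i → coeff (p +ₚ q) i ≡ coeff p i ℚ.+ coeff q i
coeff-+ []      q       i       = sym (ℚ.+-identityˡ (coeff q i))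
coeff-+ (a ∷ p) []      i       = sym (ℚ.+-identityʳ (coeff (a ∷ p) i))
coeff-+ (a ∷ p) (b ∷ q) zero    = refl
coeff-+ (a ∷ p) (b ∷ q) (suc i) = coeff-+ p q i

coeff-· : ∀ a p i → coeff (a ·ₚ p) i ≡ a ℚ.* coeff p i
coeff-· a []      i       = sym (ℚ.*-zeroʳ a)
coeff-· a (b ∷ p) zero    = refl
coeff-· a (b ∷ p) (suc i) = coeff-· a p i

private
  IsZero : ℚ[x] → Set
  IsZero p = ∀ i → coeff p i ≡ 0ℚ

  zero-∷ : ∀ {a p} → a ≡ 0ℚ → IsZero p → IsZero (a ∷ p)
  zero-∷ a≡0 p≡0 zero    = a≡0
  zero-∷ a≡0 p≡0 (suc i) = p≡0 i

  coeff-*-shift : ∀ p q i → coeff (p *ₚ (0ℚ ∷ q)) i ≡ coeff (0ℚ ∷ p *ₚ q) i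
  coeff-*-shift []      q zero    = refl
  coeff-*-shift []      q (suc i) = refl
  coeff-*-shift (a ∷ p) q zero    =
    trans (ℚ.+-identityʳ (a ℚ.* 0ℚ)) (ℚ.*-zeroʳ a)
  coeff-*-shift (a ∷ p) q (suc i) = begin
    coeff (a ·ₚ q +ₚ p *ₚ (0ℚ ∷ q)) i
      ≡⟨ coeff-+ (a ·ₚ q) (p *ₚ (0ℚ ∷ q)) i ⟩
    coeff (a ·ₚ q) i ℚ.+ coeff (p *ₚ (0ℚ ∷ q)) i
      ≡⟨ cong (coeff (a ·ₚ q) i ℚ.+_) (coeff-*-shift p q i) ⟩
    coeff (a ·ₚ q) i ℚ.+ coeff (0ℚ ∷ p *ₚ q) i
      ≡⟨ coeff-+ (a ·ₚ q) (0ℚ ∷ p *ₚ q) i ⟨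
    coeff (a ·ₚ q +ₚ (0ℚ ∷ p *ₚ q)) i
      ∎
    where open ≡-Reasoning

  head≢0⇒right≡0 : ∀ a p q → a ≢ 0ℚ → IsZero ((a ∷ p) *ₚ q) → IsZero q
  head≢0⇒right≡0 a p []      a≢0 z = λ _ → refl
  head≢0⇒right≡0 a p (b ∷ q) a≢0 z
    with p*q≡0⇒q≡0 a b a≢0 (trans (sym (ℚ.+-identityʳ (a ℚ.* b))) (z 0))
  ... | refl = zero-∷ refl (head≢0⇒right≡0 a p q a≢0
                 λ i → trans (sym (coeff-*-shift (a ∷ p) q (suc i))) (z (suc i)))

  *-zero : ∀ p q → IsZero (p *ₚ q) → IsZero p ⊎ IsZero q
  *-zero []      q z = inj₁ λ _ → refl
  *-zero (a ∷ p) q z with a ℚ.≟ 0ℚ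
  ... | no  a≢0  = inj₂ (head≢0⇒right≡0 a p q a≢0 z)
  ... | yes refl =
    [ inj₁ ∘ zero-∷ refl , inj₂ ]′ (*-zero p q λ i → trans (shift i) (z (suc i)))
    where
    open ≡-Reasoning
    shift : ∀ i → coeff (p *ₚ q) i ≡ coeff (0ℚ ·ₚ q +ₚ (0ℚ ∷ p *ₚ q)) (suc i)
    shift i = sym (begin
      coeff (0ℚ ·ₚ q +ₚ (0ℚ ∷ p *ₚ q)) (suc i)
        ≡⟨ coeff-+ (0ℚ ·ₚ q) (0ℚ ∷ p *ₚ q) (suc i) ⟩
      coeff (0ℚ ·ₚ q) (suc i) ℚ.+ coeff (p *ₚ q) i
        ≡⟨ cong (ℚ._+ coeff (p *ₚ q) i) (coeff-· 0ℚ q (suc i)) ⟩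
      0ℚ ℚ.* coeff q (suc i) ℚ.+ coeff (p *ₚ q) i
        ≡⟨ cong (ℚ._+ coeff (p *ₚ q) i) (ℚ.*-zeroˡ (coeff q (suc i))) ⟩
      0ℚ ℚ.+ coeff (p *ₚ q) i
        ≡⟨ ℚ.+-identityˡ (coeff (p *ₚ q) i) ⟩
      coeff (p *ₚ q) i
        ∎)

*ₚ-zero : ∀ p q → p *ₚ q ≈ₚ 0ₚ → p ≈ₚ 0ₚ ⊎ q ≈ₚ 0ₚ
*ₚ-zero p q pq≈0 = Sum.map coeffwise coeffwise (*-zero p q (coeff-≡ pq≈0))

*ₚ-≉0 : ∀ {p q} → p ≉ₚ 0ₚ → q ≉ₚ 0ₚ → p *ₚ q ≉ₚ 0ₚ
*ₚ-≉0 {p} {q} p≉0 q≉0 pq≈0 = [ p≉0 , q≉0 ]′ (*ₚ-zero p q pq≈0)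

1ₚ≉0 : 1ₚ ≉ₚ 0ₚ
1ₚ≉0 1≈0 with () ← coeff-≡ 1≈0 0

------------------------------------------------------------------------
-- U d ∘ₚ T m is nonzero, since its value at 1 is d + 1

eval : ℚ[x] → ℚ → ℚ
eval []      r = 0ℚ
eval (a ∷ p) r = a ℚ.+ r ℚ.* eval p r

eval-+ : ∀ p q r → eval (p +ₚ q) r ≡ eval p r ℚ.+ eval q r
eval-+ []      q       r = sym (ℚ.+-identityˡ (eval q r))
eval-+ (a ∷ p) []      r = sym (ℚ.+-identityʳ (eval (a ∷ p) r))
eval-+ (a ∷ p) (b ∷ q) r rewrite eval-+ p q r =
  solve 5 (λ a b r s t → (a :+ b) :+ r :* (s :+ t)
                      := (a :+ r :* s) :+ (b :+ r :* t))
    refl a b r (eval p r) (eval q r)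

eval-· : ∀ a p r → eval (a ·ₚ p) r ≡ a ℚ.* eval p r
eval-· a []      r = sym (ℚ.*-zeroʳ a)
eval-· a (b ∷ p) r rewrite eval-· a p r =
  solve 4 (λ a b r s → a :* b :+ r :* (a :* s) := a :* (b :+ r :* s))
    refl a b r (eval p r)

eval-neg : ∀ p r → eval (-ₚ p) r ≡ ℚ.- eval p r
eval-neg []      r = refl
eval-neg (a ∷ p) r rewrite eval-neg p r =
  solve 3 (λ a r s → (:- a) :+ r :* (:- s) := :- (a :+ r :* s))
    refl a r (eval p r)

eval-- : ∀ p q r → eval (p -ₚ q) r ≡ eval p r ℚ.- eval q r
eval-- p q r = trans (eval-+ p (-ₚ q) r) (cong (eval p r ℚ.+_) (eval-neg q r))

eval-* : ∀ p q r → eval (p *ₚ q) r ≡ eval p r ℚ.* eval q r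
eval-* []      q r = sym (ℚ.*-zeroˡ (eval q r))
eval-* (a ∷ p) q r
  rewrite eval-+ (a ·ₚ q) (0ℚ ∷ p *ₚ q) r | eval-· a q r | eval-* p q r =
  solve 4 (λ a r s t → a :* t :+ (con 0ℚ :+ r :* (s :* t))
                    := (a :+ r :* s) :* t)
    refl a r (eval p r) (eval q r)

eval-∘ : ∀ p q r → eval (p ∘ₚ q) r ≡ eval p (eval q r)
eval-∘ []      q r = refl
eval-∘ (a ∷ p) q r
  rewrite eval-+ (const a) (q *ₚ (p ∘ₚ q)) r | eval-* q (p ∘ₚ q) r | eval-∘ p q r =
  solve 4 (λ a r s t → (a :+ r :* con 0ℚ) :+ t :* s := a :+ t :* s)
    refl a r (eval p (eval q r)) (eval q r)

eval-zero : ∀ p r → p ≈ₚ 0ₚ → eval p r ≡ 0ℚ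
eval-zero []      r p≈0 = refl
eval-zero (a ∷ p) r p≈0
  rewrite coeff-≡ p≈0 0
        | eval-zero p r (coeffwise (coeff-≡ p≈0 ∘ suc)) =
  trans (ℚ.+-identityˡ (r ℚ.* 0ℚ)) (ℚ.*-zeroʳ r)

private
  eval-rec : ∀ p q → eval (2X *ₚ p -ₚ q) 1ℚ ≡ (1ℚ ℚ.+ 1ℚ) ℚ.* eval p 1ℚ ℚ.- eval q 1ℚ
  eval-rec p q =
    trans (eval-- (2X *ₚ p) q 1ℚ) (cong (ℚ._- eval q 1ℚ) (eval-* 2X p 1ℚ))

  T-at-1 : ∀ m → eval (T m) 1ℚ ≡ 1ℚ
  T-at-1 zero          = refl
  T-at-1 (suc zero)    = refl
  T-at-1 (suc (suc m)) = trans (eval-rec (T (suc m)) (T m))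
    (cong₂ (λ s t → (1ℚ ℚ.+ 1ℚ) ℚ.* s ℚ.- t) (T-at-1 (suc m)) (T-at-1 m))

  U-step : ∀ d → eval (U (suc d)) 1ℚ ≡ 1ℚ ℚ.+ eval (U d) 1ℚ
  U-step zero    = refl
  U-step (suc d) = begin
    eval (U (suc (suc d))) 1ℚ              ≡⟨ eval-rec (U (suc d)) (U d) ⟩
    (1ℚ ℚ.+ 1ℚ) ℚ.* u₁ ℚ.- u₀              ≡⟨ cong (λ s → (1ℚ ℚ.+ 1ℚ) ℚ.* s ℚ.- u₀) (U-step d) ⟩
    (1ℚ ℚ.+ 1ℚ) ℚ.* (1ℚ ℚ.+ u₀) ℚ.- u₀     ≡⟨ solve 1 (λ u → (con 1ℚ :+ con 1ℚ) :* (con 1ℚ :+ u) :- u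
                                                         := con 1ℚ :+ (con 1ℚ :+ u)) refl u₀ ⟩
    1ℚ ℚ.+ (1ℚ ℚ.+ u₀)                     ≡⟨ cong (1ℚ ℚ.+_) (U-step d) ⟨
    1ℚ ℚ.+ u₁                              ∎
    where
    open ≡-Reasoning
    u₀ = eval (U d) 1ℚ
    u₁ = eval (U (suc d)) 1ℚ

  U-at-1-positive : ∀ d → ℚ.Positive (eval (U d) 1ℚ)
  U-at-1-positive zero    = _
  U-at-1-positive (suc d) = subst ℚ.Positive (sym (U-step d))
    (ℚ.pos+pos⇒pos 1ℚ (eval (U d) 1ℚ) {{U-at-1-positive d}})

U∘T≉0 : ∀ d m → U d ∘ₚ T m ≉ₚ 0ₚ
U∘T≉0 d m UT≈0 = ℚ.<⇒≢ (ℚ.positive⁻¹ (eval (U d) 1ℚ) {{U-at-1-positive d}}) (sym U-at-1≡0)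
  where
  open ≡-Reasoning
  U-at-1≡0 : eval (U d) 1ℚ ≡ 0ℚ
  U-at-1≡0 = begin
    eval (U d) 1ℚ              ≡⟨ cong (eval (U d)) (T-at-1 m) ⟨
    eval (U d) (eval (T m) 1ℚ) ≡⟨ eval-∘ (U d) (T m) 1ℚ ⟨
    eval (U d ∘ₚ T m) 1ℚ       ≡⟨ eval-zero (U d ∘ₚ T m) 1ℚ UT≈0 ⟩
    0ℚ                         ∎

------------------------------------------------------------------------
-- The field of fractions of ℚ[x]

infix 10 _/_⟨_⟩

record ℚ⟨x⟩ : Set where
  constructor _/_⟨_⟩
  field
    num   : ℚ[x]
    den   : ℚ[x]
    den≉0 : den ≉ₚ 0ₚ

open ℚ⟨x⟩ public

infix  4 _≈_
infixl 6 _+_ _-_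
infixl 7 _*_
infix  8 -_

record _≈_ (f g : ℚ⟨x⟩) : Set where
  constructor cross
  field cross-≈ : num f *ₚ den g ≈ₚ num g *ₚ den f

open _≈_ public

fromPoly : ℚ[x] → ℚ⟨x⟩
fromPoly p = p / 1ₚ ⟨ 1ₚ≉0 ⟩

0# 1# : ℚ⟨x⟩
0# = fromPoly 0ₚ
1# = fromPoly 1ₚ

_+_ : ℚ⟨x⟩ → ℚ⟨x⟩ → ℚ⟨x⟩
(p / q ⟨ q≉0 ⟩) + (r / s ⟨ s≉0 ⟩) =
  (p *ₚ s +ₚ r *ₚ q) / (q *ₚ s) ⟨ *ₚ-≉0 q≉0 s≉0 ⟩

_*_ : ℚ⟨x⟩ → ℚ⟨x⟩ → ℚ⟨x⟩
(p / q ⟨ q≉0 ⟩) * (r / s ⟨ s≉0 ⟩) = (p *ₚ r) / (q *ₚ s) ⟨ *ₚ-≉0 q≉0 s≉0 ⟩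

-_ : ℚ⟨x⟩ → ℚ⟨x⟩
- (p / q ⟨ q≉0 ⟩) = (-ₚ p) / q ⟨ q≉0 ⟩

_-_ : ℚ⟨x⟩ → ℚ⟨x⟩ → ℚ⟨x⟩
f - g = f + - g

ℚ⟨x⟩-rawRing : RawRing 0ℓ 0ℓ
ℚ⟨x⟩-rawRing = record
  { Carrier = ℚ⟨x⟩
  ; _≈_ = _≈_
  ; _+_ = _+_
  ; _*_ = _*_
  ; -_  = -_
  ; 0#  = 0#
  ; 1#  = 1#
  }

open RawSemiringDefinitions (RawRing.rawSemiring ℚ⟨x⟩-rawRing) public
  using (_^_; sum; product)

-- ∑[ k ≤ n ] and ∏[ k ≤ n ] range over k = 0, …, n inclusive.

∑≤ ∏≤ : ℕ → (ℕ → ℚ⟨x⟩) → ℚ⟨x⟩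
∑≤ n f = sum     {suc n} (f ∘ toℕ)
∏≤ n f = product {suc n} (f ∘ toℕ)

infixl 7 ∑≤ ∏≤
syntax ∑≤ n (λ k → f) = ∑[ k ≤ n ] f
syntax ∏≤ n (λ k → f) = ∏[ k ≤ n ] f

------------------------------------------------------------------------
-- The sum S n d

1/U∘T : (d m : ℕ) → ℚ⟨x⟩
1/U∘T d m = 1ₚ / (U d ∘ₚ T m) ⟨ U∘T≉0 d m ⟩

-- Only d ≥ 1 is meaningful: truncated subtraction turns U (d ∸ 1) into
-- U 0 when d = 0.

S : (n d : ℕ) → ℚ⟨x⟩
S n d = ∑[ k ≤ n ] (fromPoly (U (d ℕ.∸ 1) ∘ₚ T ((d ℕ.+ 1) ℕ.^ k))
                    * (∏[ j ≤ k ] 1/U∘T d ((d ℕ.+ 1) ℕ.^ j)))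

{-# OPTIONS --safe #-}

-- Put b = d + 1 and let U_{-1} = 0, U_{-2} = -1. Every solution f of
-- f(n+2) = 2x f(n+1) - f(n) satisfies f(2m+n) + f(n) = 2 T_m f(m+n), so
-- k ↦ f(km) solves the same recurrence with x replaced by T_m, whence
--   f(bm) = f(m) (U_d ∘ T_m) - f(0) (U_{d-1} ∘ T_m).
-- For f(n) = U_{n-1} the product over j ≤ n telescopes to 1 / U_{b^(n+1) - 1};
-- for f(n) = U_{n-2} the sum telescopes to U_{b^(n+1) - 2} / U_{b^(n+1) - 1}.
-- The identity is then w² - 2xwv + v² = 1 for w = U_{m-2} and v = U_{m-1},
-- since this quadratic form is invariant under the recurrence.

module Submission where

open import Defs
open import Data.Nat.Base as ℕ using (ℕ; _≥_)

open import Algebra.Bundles using (AbelianGroup; CommutativeMonoid; CommutativeRing; Monoid)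
import Algebra.Construct.Pointwise as Pointwise
import Algebra.Morphism.GroupMonomorphism as GroupMonomorphism
open import Algebra.Morphism.Structures using (IsGroupMonomorphism)
import Algebra.Properties.CommutativeSemigroup as CommutativeSemigroupProperties
import Algebra.Properties.Monoid.Sum as MonoidSum
import Algebra.Solver.Ring as RingSolver
open import Algebra.Solver.Ring.AlmostCommutativeRing
  using (fromCommutativeRing; _-Raw-AlmostCommutative⟶_)
open import Algebra.Structures using (IsAbelianGroup; IsCommutativeRing)
open import Algebra.Structures.Biased using (isCommutativeMonoidˡ)
open import Data.Fin.Base using (toℕ)
open import Data.Fin.Properties using (toℕ-fromℕ; toℕ-inject₁)
open import Data.List.Base using ([]; _∷_)
import Data.Maybe.Base as Maybe
open import Data.Nat.Base using (zero; suc; s≤s)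
import Data.Nat.Properties as ℕ
open import Data.Product.Base using (_,_)
open import Data.Rational.Base as ℚ using (ℚ; 0ℚ; 1ℚ)
import Data.Rational.Properties as ℚ
open import Data.Sum.Base using ([_,_]′)
open import Function.Base using (_∘_)
open import Level using (0ℓ)
open import Relation.Binary.PropositionalEquality as ≡ using (_≡_; cong; cong₂)
import Relation.Binary.Reasoning.Setoid as SetoidReasoning
open import Relation.Binary.Structures using (IsEquivalence)
open import Relation.Nullary using (contradiction)
open import Relation.Nullary.Decidable using (dec⇒maybe)

-- The ring ℚ[x]

coeff-neg : ∀ p i → coeff (-ₚ p) i ≡ ℚ.- coeff p i
coeff-neg []      i       = ≡.refl
coeff-neg (a ∷ p) zero    = ≡.refl
coeff-neg (a ∷ p) (suc i) = coeff-neg p i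

-- `coeff` carries the operations to pointwise ones on `ℕ → ℚ`, and it is injective because `_≈ₚ_`
-- is equality of all coefficients. The group laws are therefore pulled back from ℚ, with no
-- induction on lists.
+ₚ-isAbelianGroup : IsAbelianGroup _≈ₚ_ _+ₚ_ 0ₚ (-ₚ_)
+ₚ-isAbelianGroup = GroupMonomorphism.isAbelianGroup coeff-isGroupMonomorphism
  (Pointwise.isAbelianGroup ℕ ℚ.+-0-isAbelianGroup)
  where
  coeff-isGroupMonomorphism : IsGroupMonomorphism
    (record { _≈_ = _≈ₚ_ ; _∙_ = _+ₚ_ ; ε = 0ₚ ; _⁻¹ = (-ₚ_) })
    (record { _≈_ = λ f g → ∀ i → f i ≡ g i
            ; _∙_ = λ f g i → f i ℚ.+ g i
            ; ε   = λ _ → 0ℚ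
            ; _⁻¹ = λ f i → ℚ.- f i })
    coeff
  coeff-isGroupMonomorphism = record
    { isGroupHomomorphism = record
      { isMonoidHomomorphism = record
        { isMagmaHomomorphism = record
          { isRelHomomorphism = record { cong = coeff-≡ }
          ; homo = coeff-+
          }
        ; ε-homo = λ _ → ≡.refl
        }
      ; ⁻¹-homo = coeff-neg
      }
    ; injective = coeffwise
    }

open IsAbelianGroup +ₚ-isAbelianGroup public
  using (refl; sym; trans; setoid)
  renaming ( ∙-cong to +ₚ-cong; ∙-congˡ to +ₚ-congˡ; ∙-congʳ to +ₚ-congʳ
           ; assoc to +ₚ-assoc; identityʳ to +ₚ-identityʳ; inverseʳ to -ₚ‿inverseʳ; comm to +ₚ-comm )

+ₚ-abelianGroup : AbelianGroup 0ℓ 0ℓ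
+ₚ-abelianGroup = record { isAbelianGroup = +ₚ-isAbelianGroup }

open CommutativeSemigroupProperties (AbelianGroup.commutativeSemigroup +ₚ-abelianGroup)
  using () renaming (interchange to +ₚ-interchange)

open SetoidReasoning setoid

∷-cong : ∀ {a b p q} → a ≡ b → p ≈ₚ q → a ∷ p ≈ₚ b ∷ q
∷-cong a≡b p≈q = coeffwise λ { zero → a≡b ; (suc i) → coeff-≡ p≈q i }

-- Bridges the two representations of zero: recursion on lists and the constant `const 0ℚ` leave a
-- trailing zero, whereas `0ₚ` is the empty list.
0∷[]≈0 : 0ℚ ∷ [] ≈ₚ 0ₚ
0∷[]≈0 = coeffwise λ { zero → ≡.refl ; (suc i) → ≡.refl }

·-cong : ∀ {a b p q} → a ≡ b → p ≈ₚ q → a ·ₚ p ≈ₚ b ·ₚ q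
·-cong {a} {b} {p} {q} a≡b p≈q = coeffwise λ i →
  ≡.trans (coeff-· a p i)
    (≡.trans (cong₂ ℚ._*_ a≡b (coeff-≡ p≈q i)) (≡.sym (coeff-· b q i)))

·-distribˡ : ∀ a p q → a ·ₚ (p +ₚ q) ≈ₚ a ·ₚ p +ₚ a ·ₚ q
·-distribˡ a []      q       = refl
·-distribˡ a (b ∷ p) []      = refl
·-distribˡ a (b ∷ p) (c ∷ q) = ∷-cong (ℚ.*-distribˡ-+ a b c) (·-distribˡ a p q)

·-distribʳ : ∀ a b p → (a ℚ.+ b) ·ₚ p ≈ₚ a ·ₚ p +ₚ b ·ₚ p
·-distribʳ a b []      = refl
·-distribʳ a b (c ∷ p) = ∷-cong (ℚ.*-distribʳ-+ c a b) (·-distribʳ a b p)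

·-assoc : ∀ a b p → (a ℚ.* b) ·ₚ p ≈ₚ a ·ₚ (b ·ₚ p)
·-assoc a b []      = refl
·-assoc a b (c ∷ p) = ∷-cong (ℚ.*-assoc a b c) (·-assoc a b p)

·-identity : ∀ p → 1ℚ ·ₚ p ≈ₚ p
·-identity []      = refl
·-identity (a ∷ p) = ∷-cong (ℚ.*-identityˡ a) (·-identity p)

·-zero : ∀ p → 0ℚ ·ₚ p ≈ₚ 0ₚ
·-zero p = coeffwise λ i → ≡.trans (coeff-· 0ℚ p i) (ℚ.*-zeroˡ (coeff p i))

·-*-assoc : ∀ a p q → (a ·ₚ p) *ₚ q ≈ₚ a ·ₚ (p *ₚ q)
·-*-assoc a []      q = refl
·-*-assoc a (b ∷ p) q = begin
  (a ℚ.* b) ·ₚ q +ₚ (0ℚ ∷ (a ·ₚ p) *ₚ q)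
    ≈⟨ +ₚ-cong (·-assoc a b q) (∷-cong (≡.sym (ℚ.*-zeroʳ a)) (·-*-assoc a p q)) ⟩
  a ·ₚ (b ·ₚ q) +ₚ a ·ₚ (0ℚ ∷ p *ₚ q)
    ≈⟨ ·-distribˡ a (b ·ₚ q) (0ℚ ∷ p *ₚ q) ⟨
  a ·ₚ (b ·ₚ q +ₚ (0ℚ ∷ p *ₚ q)) ∎

*ₚ-congˡ : ∀ p {q r} → q ≈ₚ r → p *ₚ q ≈ₚ p *ₚ r
*ₚ-congˡ []      q≈r = refl
*ₚ-congˡ (a ∷ p) q≈r =
  +ₚ-cong (·-cong {a} ≡.refl q≈r) (∷-cong ≡.refl (*ₚ-congˡ p q≈r))

*ₚ-zeroʳ : ∀ p → p *ₚ 0ₚ ≈ₚ 0ₚ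
*ₚ-zeroʳ []      = refl
*ₚ-zeroʳ (a ∷ p) = trans (∷-cong ≡.refl (*ₚ-zeroʳ p)) 0∷[]≈0

-- Multiplication is defined by recursion on its left factor. This is the mirror rule for the right
-- factor, and commutativity follows from the two by induction.
*ₚ-∷ : ∀ p b q → p *ₚ (b ∷ q) ≈ₚ b ·ₚ p +ₚ (0ℚ ∷ p *ₚ q)
*ₚ-∷ []      b q = sym 0∷[]≈0
*ₚ-∷ (a ∷ p) b q = ∷-cong (cong (ℚ._+ 0ℚ) (ℚ.*-comm a b)) (begin
  a ·ₚ q +ₚ p *ₚ (b ∷ q)                ≈⟨ +ₚ-congˡ {a ·ₚ q} (*ₚ-∷ p b q) ⟩
  a ·ₚ q +ₚ (b ·ₚ p +ₚ (0ℚ ∷ p *ₚ q))   ≈⟨ +ₚ-assoc (a ·ₚ q) (b ·ₚ p) _ ⟨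
  (a ·ₚ q +ₚ b ·ₚ p) +ₚ (0ℚ ∷ p *ₚ q)   ≈⟨ +ₚ-congʳ (+ₚ-comm (a ·ₚ q) (b ·ₚ p)) ⟩
  (b ·ₚ p +ₚ a ·ₚ q) +ₚ (0ℚ ∷ p *ₚ q)   ≈⟨ +ₚ-assoc (b ·ₚ p) (a ·ₚ q) _ ⟩
  b ·ₚ p +ₚ (a ·ₚ q +ₚ (0ℚ ∷ p *ₚ q))   ∎)

*ₚ-comm : ∀ p q → p *ₚ q ≈ₚ q *ₚ p
*ₚ-comm []      q = sym (*ₚ-zeroʳ q)
*ₚ-comm (a ∷ p) q = begin
  a ·ₚ q +ₚ (0ℚ ∷ p *ₚ q) ≈⟨ +ₚ-congˡ {a ·ₚ q} (∷-cong ≡.refl (*ₚ-comm p q)) ⟩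
  a ·ₚ q +ₚ (0ℚ ∷ q *ₚ p) ≈⟨ *ₚ-∷ q a p ⟨
  q *ₚ (a ∷ p)            ∎

-- Equal polynomials may be lists of different lengths, which makes induction on the left factors
-- awkward. Commutativity moves each change to the right factor, where `*ₚ-congˡ` applies.
*ₚ-cong : ∀ {p q r s} → p ≈ₚ q → r ≈ₚ s → p *ₚ r ≈ₚ q *ₚ s
*ₚ-cong {p} {q} {r} {s} p≈q r≈s = begin
  p *ₚ r ≈⟨ *ₚ-congˡ p r≈s ⟩
  p *ₚ s ≈⟨ *ₚ-comm p s ⟩
  s *ₚ p ≈⟨ *ₚ-congˡ s p≈q ⟩
  s *ₚ q ≈⟨ *ₚ-comm s q ⟩
  q *ₚ s ∎

*ₚ-congʳ : ∀ r {p q} → p ≈ₚ q → p *ₚ r ≈ₚ q *ₚ r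
*ₚ-congʳ r p≈q = *ₚ-cong p≈q refl

*ₚ-distribʳ : ∀ r p q → (p +ₚ q) *ₚ r ≈ₚ p *ₚ r +ₚ q *ₚ r
*ₚ-distribʳ r []      q       = refl
*ₚ-distribʳ r (a ∷ p) []      = sym (+ₚ-identityʳ _)
*ₚ-distribʳ r (a ∷ p) (b ∷ q) = begin
  (a ℚ.+ b) ·ₚ r +ₚ (0ℚ ∷ (p +ₚ q) *ₚ r)
    ≈⟨ +ₚ-cong (·-distribʳ a b r) (∷-cong ≡.refl (*ₚ-distribʳ r p q)) ⟩
  (a ·ₚ r +ₚ b ·ₚ r) +ₚ ((0ℚ ∷ p *ₚ r) +ₚ (0ℚ ∷ q *ₚ r))
    ≈⟨ +ₚ-interchange (a ·ₚ r) (b ·ₚ r) _ _ ⟩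
  (a ·ₚ r +ₚ (0ℚ ∷ p *ₚ r)) +ₚ (b ·ₚ r +ₚ (0ℚ ∷ q *ₚ r)) ∎

*ₚ-distribˡ : ∀ r p q → r *ₚ (p +ₚ q) ≈ₚ r *ₚ p +ₚ r *ₚ q
*ₚ-distribˡ r p q = begin
  r *ₚ (p +ₚ q)    ≈⟨ *ₚ-comm r (p +ₚ q) ⟩
  (p +ₚ q) *ₚ r    ≈⟨ *ₚ-distribʳ r p q ⟩
  p *ₚ r +ₚ q *ₚ r ≈⟨ +ₚ-cong (*ₚ-comm p r) (*ₚ-comm q r) ⟩
  r *ₚ p +ₚ r *ₚ q ∎

*ₚ-assoc : ∀ p q r → (p *ₚ q) *ₚ r ≈ₚ p *ₚ (q *ₚ r)
*ₚ-assoc []      q r = refl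
*ₚ-assoc (a ∷ p) q r = begin
  (a ·ₚ q +ₚ (0ℚ ∷ p *ₚ q)) *ₚ r
    ≈⟨ *ₚ-distribʳ r (a ·ₚ q) (0ℚ ∷ p *ₚ q) ⟩
  (a ·ₚ q) *ₚ r +ₚ (0ℚ ·ₚ r +ₚ (0ℚ ∷ (p *ₚ q) *ₚ r))
    ≈⟨ +ₚ-cong (·-*-assoc a q r) (+ₚ-cong (·-zero r) (∷-cong ≡.refl (*ₚ-assoc p q r))) ⟩
  a ·ₚ (q *ₚ r) +ₚ (0ℚ ∷ p *ₚ (q *ₚ r)) ∎

·≈const-* : ∀ a p → a ·ₚ p ≈ₚ const a *ₚ p
·≈const-* a p = sym (trans (+ₚ-congˡ {a ·ₚ p} 0∷[]≈0) (+ₚ-identityʳ (a ·ₚ p)))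

*ₚ-identityˡ : ∀ p → 1ₚ *ₚ p ≈ₚ p
*ₚ-identityˡ p = trans (sym (·≈const-* 1ℚ p)) (·-identity p)

*ₚ-isCommutativeRing : IsCommutativeRing _≈ₚ_ _+ₚ_ _*ₚ_ (-ₚ_) 0ₚ 1ₚ
*ₚ-isCommutativeRing = record
  { isRing = record
    { +-isAbelianGroup = +ₚ-isAbelianGroup
    ; *-cong     = *ₚ-cong
    ; *-assoc    = *ₚ-assoc
    ; *-identity = *ₚ-identityˡ , λ p → trans (*ₚ-comm p 1ₚ) (*ₚ-identityˡ p)
    ; distrib    = *ₚ-distribˡ , *ₚ-distribʳ
    }
  ; *-comm = *ₚ-comm
  }

ℚ[x]-commutativeRing : CommutativeRing 0ℓ 0ℓ
ℚ[x]-commutativeRing = record { isCommutativeRing = *ₚ-isCommutativeRing }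

open CommutativeRing ℚ[x]-commutativeRing using (-‿cong; reflexive)

const-* : ∀ a b → const (a ℚ.* b) ≈ₚ const a *ₚ const b
const-* a b = ∷-cong (≡.sym (ℚ.+-identityʳ (a ℚ.* b))) refl

-- Lets the ring solver compute with coefficients in ℚ, so that `con 2ℚ` stands for the constant
-- polynomial 2.
const-homomorphism : ℚ.+-*-rawRing -Raw-AlmostCommutative⟶ fromCommutativeRing ℚ[x]-commutativeRing
const-homomorphism = record
  { ⟦_⟧    = const
  ; +-homo = λ _ _ → refl
  ; *-homo = const-*
  ; -‿homo = λ _ → refl
  ; 0-homo = 0∷[]≈0
  ; 1-homo = refl
  }

open RingSolver ℚ.+-*-rawRing (fromCommutativeRing ℚ[x]-commutativeRing) const-homomorphism
  (λ a b → Maybe.map (reflexive ∘ cong const) (dec⇒maybe (a ℚ.≟ b)))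
  using (solve; _:=_; _:+_; _:*_; _:-_; :-_; con)

-- Composition

∘-+ : ∀ p q r → (p +ₚ q) ∘ₚ r ≈ₚ p ∘ₚ r +ₚ q ∘ₚ r
∘-+ []      q       r = refl
∘-+ (a ∷ p) []      r = sym (+ₚ-identityʳ _)
∘-+ (a ∷ p) (b ∷ q) r = begin
  const (a ℚ.+ b) +ₚ r *ₚ ((p +ₚ q) ∘ₚ r)
    ≈⟨ +ₚ-congˡ {const (a ℚ.+ b)} (*ₚ-congˡ r (∘-+ p q r)) ⟩
  const a +ₚ const b +ₚ r *ₚ (p ∘ₚ r +ₚ q ∘ₚ r)
    ≈⟨ solve 5 (λ a b r s t → a :+ b :+ r :* (s :+ t) := (a :+ r :* s) :+ (b :+ r :* t))
         refl (const a) (const b) r (p ∘ₚ r) (q ∘ₚ r) ⟩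
  (a ∷ p) ∘ₚ r +ₚ (b ∷ q) ∘ₚ r ∎

∘-neg : ∀ p r → (-ₚ p) ∘ₚ r ≈ₚ -ₚ (p ∘ₚ r)
∘-neg []      r = refl
∘-neg (a ∷ p) r = begin
  -ₚ const a +ₚ r *ₚ ((-ₚ p) ∘ₚ r)
    ≈⟨ +ₚ-congˡ { -ₚ const a} (*ₚ-congˡ r (∘-neg p r)) ⟩
  -ₚ const a +ₚ r *ₚ (-ₚ (p ∘ₚ r))
    ≈⟨ solve 3 (λ a r s → :- a :+ r :* (:- s) := :- (a :+ r :* s))
         refl (const a) r (p ∘ₚ r) ⟩
  -ₚ ((a ∷ p) ∘ₚ r) ∎

∘-· : ∀ a p r → (a ·ₚ p) ∘ₚ r ≈ₚ const a *ₚ (p ∘ₚ r)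
∘-· a []      r = sym (*ₚ-zeroʳ (const a))
∘-· a (b ∷ p) r = begin
  const (a ℚ.* b) +ₚ r *ₚ ((a ·ₚ p) ∘ₚ r)
    ≈⟨ +ₚ-cong (const-* a b) (*ₚ-congˡ r (∘-· a p r)) ⟩
  const a *ₚ const b +ₚ r *ₚ (const a *ₚ (p ∘ₚ r))
    ≈⟨ solve 4 (λ a b r s → a :* b :+ r :* (a :* s) := a :* (b :+ r :* s))
         refl (const a) (const b) r (p ∘ₚ r) ⟩
  const a *ₚ ((b ∷ p) ∘ₚ r) ∎

∘-* : ∀ p q r → (p *ₚ q) ∘ₚ r ≈ₚ (p ∘ₚ r) *ₚ (q ∘ₚ r)
∘-* []      q r = refl
∘-* (a ∷ p) q r = begin
  (a ·ₚ q +ₚ (0ℚ ∷ p *ₚ q)) ∘ₚ r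
    ≈⟨ ∘-+ (a ·ₚ q) (0ℚ ∷ p *ₚ q) r ⟩
  (a ·ₚ q) ∘ₚ r +ₚ (const 0ℚ +ₚ r *ₚ ((p *ₚ q) ∘ₚ r))
    ≈⟨ +ₚ-cong (∘-· a q r) (+ₚ-congˡ {const 0ℚ} (*ₚ-congˡ r (∘-* p q r))) ⟩
  const a *ₚ (q ∘ₚ r) +ₚ (const 0ℚ +ₚ r *ₚ ((p ∘ₚ r) *ₚ (q ∘ₚ r)))
    ≈⟨ solve 4 (λ a r s t → a :* t :+ (con 0ℚ :+ r :* (s :* t)) := (a :+ r :* s) :* t)
         refl (const a) r (p ∘ₚ r) (q ∘ₚ r) ⟩
  ((a ∷ p) ∘ₚ r) *ₚ (q ∘ₚ r) ∎

const-∘ : ∀ a r → const a ∘ₚ r ≈ₚ const a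
const-∘ a r = trans (+ₚ-congˡ {const a} (*ₚ-zeroʳ r)) (+ₚ-identityʳ (const a))

2ℚ : ℚ
2ℚ = 1ℚ ℚ.+ 1ℚ

2X-∘ : ∀ r → 2X ∘ₚ r ≈ₚ const 2ℚ *ₚ r
2X-∘ r = begin
  2X ∘ₚ r                                        ≈⟨ ∘-· 2ℚ X r ⟩
  const 2ℚ *ₚ (const 0ℚ +ₚ r *ₚ (const 1ℚ ∘ₚ r)) ≈⟨ *ₚ-congˡ (const 2ℚ) (+ₚ-congˡ {const 0ℚ} (*ₚ-congˡ r (const-∘ 1ℚ r))) ⟩
  const 2ℚ *ₚ (const 0ℚ +ₚ r *ₚ 1ₚ)              ≈⟨ solve 1 (λ r → con 2ℚ :* (con 0ℚ :+ r :* con 1ℚ) := con 2ℚ :* r) refl r ⟩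
  const 2ℚ *ₚ r                                  ∎

-- Chebyshev recurrences

-- The multiplier is left general: it is `2X` for the Chebyshev sequences and `2 T_m` for their
-- subsequences along multiples of `m`.
record Recurrence (y : ℚ[x]) (f : ℕ → ℚ[x]) : Set where
  constructor recurrence
  field step : ∀ n → f (suc (suc n)) ≈ₚ y *ₚ f (suc n) -ₚ f n

open Recurrence

-- U₋₁ n = U_{n-1} and U₋₂ n = U_{n-2}, where U_{-1} = 0 and U_{-2} = -1.

U₋₁ : ℕ → ℚ[x]
U₋₁ zero    = 0ₚ
U₋₁ (suc n) = U n

U₋₂ : ℕ → ℚ[x]
U₋₂ zero    = -ₚ 1ₚ
U₋₂ (suc n) = U₋₁ n

U₋₁-recurrence : Recurrence 2X U₋₁
step U₋₁-recurrence zero    = begin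
  2X             ≈⟨ solve 1 (λ x → x := x :* con 1ℚ) refl 2X ⟩
  2X *ₚ 1ₚ       ≈⟨ +ₚ-identityʳ (2X *ₚ 1ₚ) ⟨
  2X *ₚ 1ₚ -ₚ 0ₚ ∎
step U₋₁-recurrence (suc n) = refl

U₋₂-recurrence : Recurrence 2X U₋₂
step U₋₂-recurrence zero    = +ₚ-congʳ {1ₚ} (sym (*ₚ-zeroʳ 2X))
step U₋₂-recurrence (suc n) = step U₋₁-recurrence n

-- Composition with `r` respects sums, negation and products, and it sends the multiplier `2X` to
-- `2r`.
U₋₁-∘-recurrence : ∀ r → Recurrence (const 2ℚ *ₚ r) (λ n → U₋₁ n ∘ₚ r)
step (U₋₁-∘-recurrence r) zero    = begin
  2X ∘ₚ r                                   ≈⟨ 2X-∘ r ⟩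
  const 2ℚ *ₚ r                             ≈⟨ solve 1 (λ y → y := y :* con 1ℚ) refl (const 2ℚ *ₚ r) ⟩
  const 2ℚ *ₚ r *ₚ 1ₚ                       ≈⟨ *ₚ-congˡ (const 2ℚ *ₚ r) (const-∘ 1ℚ r) ⟨
  const 2ℚ *ₚ r *ₚ (1ₚ ∘ₚ r)                ≈⟨ +ₚ-identityʳ _ ⟨
  const 2ℚ *ₚ r *ₚ (1ₚ ∘ₚ r) -ₚ 0ₚ          ∎
step (U₋₁-∘-recurrence r) (suc n) = begin
  (2X *ₚ U (suc n) -ₚ U n) ∘ₚ r                    ≈⟨ ∘-+ (2X *ₚ U (suc n)) (-ₚ U n) r ⟩
  (2X *ₚ U (suc n)) ∘ₚ r +ₚ (-ₚ U n) ∘ₚ r          ≈⟨ +ₚ-cong (∘-* 2X (U (suc n)) r) (∘-neg (U n) r) ⟩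
  (2X ∘ₚ r) *ₚ (U (suc n) ∘ₚ r) -ₚ U n ∘ₚ r        ≈⟨ +ₚ-congʳ (*ₚ-congʳ (U (suc n) ∘ₚ r) (2X-∘ r)) ⟩
  const 2ℚ *ₚ r *ₚ (U (suc n) ∘ₚ r) -ₚ U n ∘ₚ r    ∎

U₋₂-U₋₁-norm : ∀ n → U₋₂ n *ₚ U₋₂ n -ₚ 2X *ₚ (U₋₂ n *ₚ U₋₁ n) +ₚ U₋₁ n *ₚ U₋₁ n ≈ₚ 1ₚ
-- Here `w = -1` and `v = 0`, so the left side is 1 up to trailing zeros and every coefficient is
-- settled by computation.
U₋₂-U₋₁-norm zero    = coeffwise λ
  { 0 → ≡.refl ; 1 → ≡.refl ; 2 → ≡.refl ; (suc (suc (suc i))) → ≡.refl }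
U₋₂-U₋₁-norm (suc n) = begin
  v *ₚ v -ₚ 2X *ₚ (v *ₚ v′) +ₚ v′ *ₚ v′
    ≈⟨ +ₚ-cong (+ₚ-congˡ {v *ₚ v} (-‿cong (*ₚ-congˡ 2X (*ₚ-congˡ v v′≈)))) (*ₚ-cong v′≈ v′≈) ⟩
  v *ₚ v -ₚ 2X *ₚ (v *ₚ (2X *ₚ v -ₚ w)) +ₚ (2X *ₚ v -ₚ w) *ₚ (2X *ₚ v -ₚ w)
    ≈⟨ solve 3 (λ x v w → v :* v :- x :* (v :* (x :* v :- w)) :+ (x :* v :- w) :* (x :* v :- w)
                       := w :* w :- x :* (w :* v) :+ v :* v) refl 2X v w ⟩
  w *ₚ w -ₚ 2X *ₚ (w *ₚ v) +ₚ v *ₚ v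
    ≈⟨ U₋₂-U₋₁-norm n ⟩
  1ₚ ∎
  where
  v = U₋₁ n
  w = U₋₂ n
  v′ = U₋₁ (suc n)
  v′≈ : v′ ≈ₚ 2X *ₚ v -ₚ w
  v′≈ = step U₋₂-recurrence n

-- Analogue of `cos(a+b) + cos(a-b) = 2 cos a cos b`: the two indices lie at distance `m` on either
-- side of the centre `m + n`. Writing the lower one as `n` avoids subtraction.
recurrence-sum : ∀ {f} → Recurrence 2X f → ∀ m n →
  f (m ℕ.+ (m ℕ.+ n)) +ₚ f n ≈ₚ const 2ℚ *ₚ T m *ₚ f (m ℕ.+ n)
recurrence-sum {f} rec zero n =
  solve 1 (λ p → p :+ p := con 2ℚ :* con 1ℚ :* p) refl (f n)
recurrence-sum {f} rec (suc zero) n = begin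
  f (2 ℕ.+ n) +ₚ f n                    ≈⟨ +ₚ-congʳ (step rec n) ⟩
  2X *ₚ f (1 ℕ.+ n) -ₚ f n +ₚ f n       ≈⟨ solve 3 (λ x p q → x :* p :- q :+ q := x :* p) refl 2X (f (1 ℕ.+ n)) (f n) ⟩
  2X *ₚ f (1 ℕ.+ n)                     ≈⟨ *ₚ-congʳ (f (1 ℕ.+ n)) (·≈const-* 2ℚ X) ⟩
  const 2ℚ *ₚ X *ₚ f (1 ℕ.+ n)          ∎
recurrence-sum {f} rec (suc (suc m)) n
  -- The shifts of `n` give both induction hypotheses the centre `m + n + 2` of the goal, with
  -- distances `m + 1` and `m`.
  with recurrence-sum rec (suc m) (suc n) | recurrence-sum rec m (suc (suc n))
... | ih₁ | ih₀
  rewrite ℕ.+-suc m (suc n) | ℕ.+-suc m n | ℕ.+-suc m (suc (m ℕ.+ n)) | ℕ.+-suc m (m ℕ.+ n) = begin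
  f (4 ℕ.+ k) +ₚ f n
    ≈⟨ +ₚ-congʳ (step rec (2 ℕ.+ k)) ⟩
  2X *ₚ f (3 ℕ.+ k) -ₚ f (2 ℕ.+ k) +ₚ f n
    -- Adding and subtracting `2X *ₚ f (1 ℕ.+ n)` completes the first hypothesis; what remains,
    -- `2X *ₚ f (1 ℕ.+ n) -ₚ f n`, is `f (2 ℕ.+ n)` and completes the second.
    ≈⟨ solve 5 (λ x p q r s → x :* p :- q :+ r
                           := x :* (p :+ s) :- (q :+ (x :* s :- r)))
         refl 2X (f (3 ℕ.+ k)) (f (2 ℕ.+ k)) (f n) (f (1 ℕ.+ n)) ⟩
  2X *ₚ (f (3 ℕ.+ k) +ₚ f (1 ℕ.+ n)) -ₚ (f (2 ℕ.+ k) +ₚ (2X *ₚ f (1 ℕ.+ n) -ₚ f n))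
    ≈⟨ +ₚ-cong (*ₚ-congˡ 2X ih₁)
         (-‿cong (trans (+ₚ-congˡ {f (2 ℕ.+ k)} (sym (step rec n))) ih₀)) ⟩
  2X *ₚ (const 2ℚ *ₚ T (suc m) *ₚ p) -ₚ const 2ℚ *ₚ T m *ₚ p
    ≈⟨ solve 4 (λ x s t p → x :* (con 2ℚ :* s :* p) :- con 2ℚ :* t :* p
                         := con 2ℚ :* (x :* s :- t) :* p)
         refl 2X (T (suc m)) (T m) p ⟩
  const 2ℚ *ₚ T (2 ℕ.+ m) *ₚ p ∎
  where
  k = m ℕ.+ (m ℕ.+ n)
  p = f (2 ℕ.+ (m ℕ.+ n))

-- This is `recurrence-sum` at `n = k m`, since `suc (suc k) ℕ.* m` unfolds to
-- `m ℕ.+ (m ℕ.+ k ℕ.* m)`.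
recurrence-dilate : ∀ {f} → Recurrence 2X f → ∀ m →
  Recurrence (const 2ℚ *ₚ T m) (λ k → f (k ℕ.* m))
step (recurrence-dilate {f} rec m) k = begin
  p                                                        ≈⟨ solve 2 (λ p q → p := p :+ q :- q) refl p q ⟩
  p +ₚ q -ₚ q                                              ≈⟨ +ₚ-congʳ (recurrence-sum rec m (k ℕ.* m)) ⟩
  const 2ℚ *ₚ T m *ₚ f (suc k ℕ.* m) -ₚ q                  ∎
  where
  p = f (suc (suc k) ℕ.* m)
  q = f (k ℕ.* m)

-- Both sides satisfy the same second-order recurrence in `n`, so agreement at two consecutive
-- indices suffices. Using `U₋₁` makes the coefficient of `f 0` vanish at `n = 0`.
recurrence-solution : ∀ {f r} → Recurrence (const 2ℚ *ₚ r) f → ∀ n →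
  f (suc n) ≈ₚ f 1 *ₚ (U₋₁ (suc n) ∘ₚ r) -ₚ f 0 *ₚ (U₋₁ n ∘ₚ r)
recurrence-solution {f} {r} rec zero = begin
  f 1                                ≈⟨ solve 1 (λ p → p := p :* con 1ℚ :- con 0ℚ) refl (f 1) ⟩
  f 1 *ₚ 1ₚ -ₚ const 0ℚ              ≈⟨ +ₚ-cong (*ₚ-congˡ (f 1) (sym (const-∘ 1ℚ r)))
                                          (-‿cong (trans 0∷[]≈0 (sym (*ₚ-zeroʳ (f 0))))) ⟩
  f 1 *ₚ (1ₚ ∘ₚ r) -ₚ f 0 *ₚ 0ₚ      ∎
recurrence-solution {f} {r} rec (suc zero) = begin
  f 2                                      ≈⟨ step rec 0 ⟩
  const 2ℚ *ₚ r *ₚ f 1 -ₚ f 0              ≈⟨ solve 3 (λ y p q → y :* p :- q := p :* y :- q :* con 1ℚ) refl (const 2ℚ *ₚ r) (f 1) (f 0) ⟩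
  f 1 *ₚ (const 2ℚ *ₚ r) -ₚ f 0 *ₚ 1ₚ      ≈⟨ +ₚ-cong (*ₚ-congˡ (f 1) (sym (2X-∘ r)))
                                                (-‿cong (*ₚ-congˡ (f 0) (sym (const-∘ 1ℚ r)))) ⟩
  f 1 *ₚ (2X ∘ₚ r) -ₚ f 0 *ₚ (1ₚ ∘ₚ r)     ∎
recurrence-solution {f} {r} rec (suc (suc n)) = begin
  f (3 ℕ.+ n)
    ≈⟨ step rec (suc n) ⟩
  y *ₚ f (2 ℕ.+ n) -ₚ f (1 ℕ.+ n)
    ≈⟨ +ₚ-cong (*ₚ-congˡ y (recurrence-solution rec (suc n)))
         (-‿cong (recurrence-solution rec n)) ⟩
  y *ₚ (f 1 *ₚ u 2 -ₚ f 0 *ₚ u 1) -ₚ (f 1 *ₚ u 1 -ₚ f 0 *ₚ u 0)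
    ≈⟨ solve 6 (λ y p q u₀ u₁ u₂ → y :* (p :* u₂ :- q :* u₁) :- (p :* u₁ :- q :* u₀)
                                := p :* (y :* u₂ :- u₁) :- q :* (y :* u₁ :- u₀))
         refl y (f 1) (f 0) (u 0) (u 1) (u 2) ⟩
  f 1 *ₚ (y *ₚ u 2 -ₚ u 1) -ₚ f 0 *ₚ (y *ₚ u 1 -ₚ u 0)
    ≈⟨ +ₚ-cong (*ₚ-congˡ (f 1) (sym (step (U₋₁-∘-recurrence r) (suc n))))
         (-‿cong (*ₚ-congˡ (f 0) (sym (step (U₋₁-∘-recurrence r) n)))) ⟩
  f 1 *ₚ u 3 -ₚ f 0 *ₚ u 2 ∎
  where
  y = const 2ℚ *ₚ r
  u : ℕ → ℚ[x]
  u i = U₋₁ (i ℕ.+ n) ∘ₚ r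

-- Here `d = suc e`, so the factor `suc (suc e)` is `d + 1` and `U e` is `U_{d-1}`.
recurrence-multiple : ∀ {f} → Recurrence 2X f → ∀ e m →
  f (suc (suc e) ℕ.* m) ≈ₚ f m *ₚ (U (suc e) ∘ₚ T m) -ₚ f 0 *ₚ (U e ∘ₚ T m)
recurrence-multiple {f} rec e m = begin
  f (suc (suc e) ℕ.* m)
    ≈⟨ recurrence-solution (recurrence-dilate rec m) (suc e) ⟩
  f (1 ℕ.* m) *ₚ (U (suc e) ∘ₚ T m) -ₚ f 0 *ₚ (U e ∘ₚ T m)
    ≡⟨ cong (λ k → f k *ₚ (U (suc e) ∘ₚ T m) -ₚ f 0 *ₚ (U e ∘ₚ T m)) (ℕ.*-identityˡ m) ⟩
  f m *ₚ (U (suc e) ∘ₚ T m) -ₚ f 0 *ₚ (U e ∘ₚ T m) ∎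

U₋₁-multiple : ∀ e m → U₋₁ (suc (suc e) ℕ.* m) ≈ₚ U₋₁ m *ₚ (U (suc e) ∘ₚ T m)
U₋₁-multiple e m = trans (recurrence-multiple U₋₁-recurrence e m) (+ₚ-identityʳ _)

U₋₂-multiple : ∀ e m →
  U₋₂ (suc (suc e) ℕ.* m) ≈ₚ U₋₂ m *ₚ (U (suc e) ∘ₚ T m) +ₚ U e ∘ₚ T m
U₋₂-multiple e m = trans (recurrence-multiple U₋₂-recurrence e m)
  (solve 2 (λ p q → p :- (:- con 1ℚ) :* q := p :+ q) refl
    (U₋₂ m *ₚ (U (suc e) ∘ₚ T m)) (U e ∘ₚ T m))

-- Needed to use these polynomials as denominators. By `U₋₁-multiple` each is a product of factors
-- `U_d ∘ T_m`, which are nonzero.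
U₋₁-power≉0 : ∀ e n → U₋₁ (suc (suc e) ℕ.^ n) ≉ₚ 0ₚ
U₋₁-power≉0 e zero    = 1ₚ≉0
U₋₁-power≉0 e (suc n) ≈0 = *ₚ-≉0 (U₋₁-power≉0 e n) (U∘T≉0 (suc e) (suc (suc e) ℕ.^ n))
  (trans (sym (U₋₁-multiple e (suc (suc e) ℕ.^ n))) ≈0)

-- Rational functions

*ₚ-cancelˡ : ∀ {p q r} → p ≉ₚ 0ₚ → p *ₚ q ≈ₚ p *ₚ r → q ≈ₚ r
*ₚ-cancelˡ {p} {q} {r} p≉0 pq≈pr =
  [ (λ p≈0 → contradiction p≈0 p≉0) , q≈r ]′ (*ₚ-zero p (q -ₚ r) p[q-r]≈0)
  where
  p[q-r]≈0 : p *ₚ (q -ₚ r) ≈ₚ 0ₚ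
  p[q-r]≈0 = begin
    p *ₚ (q -ₚ r)     ≈⟨ solve 3 (λ p q r → p :* (q :- r) := p :* q :- p :* r) refl p q r ⟩
    p *ₚ q -ₚ p *ₚ r  ≈⟨ +ₚ-congʳ pq≈pr ⟩
    p *ₚ r -ₚ p *ₚ r  ≈⟨ -ₚ‿inverseʳ (p *ₚ r) ⟩
    0ₚ                ∎
  q≈r : q -ₚ r ≈ₚ 0ₚ → q ≈ₚ r
  q≈r q-r≈0 = begin
    q             ≈⟨ solve 2 (λ q r → q := q :- r :+ r) refl q r ⟩
    q -ₚ r +ₚ r   ≈⟨ +ₚ-congʳ q-r≈0 ⟩
    r             ∎

≈-isEquivalence : IsEquivalence _≈_
≈-isEquivalence = record
  { refl  = cross refl
  ; sym   = λ f≈g → cross (sym (cross-≈ f≈g))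
  -- Cross-multiplication only gives the desired equation multiplied by `den g`; cancelling that
  -- factor uses that ℚ[x] is an integral domain.
  ; trans = λ {f} {g} {h} f≈g g≈h → cross (*ₚ-cancelˡ (den≉0 g) (begin
      den g *ₚ (num f *ₚ den h) ≈⟨ solve 3 (λ p q r → p :* (q :* r) := q :* p :* r) refl (den g) (num f) (den h) ⟩
      num f *ₚ den g *ₚ den h   ≈⟨ *ₚ-congʳ (den h) (cross-≈ f≈g) ⟩
      num g *ₚ den f *ₚ den h   ≈⟨ solve 3 (λ p q r → p :* q :* r := q :* (p :* r)) refl (num g) (den f) (den h) ⟩
      den f *ₚ (num g *ₚ den h) ≈⟨ *ₚ-congˡ (den f) (cross-≈ g≈h) ⟩
      den f *ₚ (num h *ₚ den g) ≈⟨ solve 3 (λ p q r → p :* (q :* r) := r :* (q :* p)) refl (den f) (num h) (den g) ⟩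
      den g *ₚ (num h *ₚ den f) ∎))
  }

module ≈ = IsEquivalence ≈-isEquivalence

+-cong : ∀ {f g h k} → f ≈ g → h ≈ k → f + h ≈ g + k
+-cong {p / q ⟨ _ ⟩} {p′ / q′ ⟨ _ ⟩} {r / s ⟨ _ ⟩} {r′ / s′ ⟨ _ ⟩} f≈g h≈k = cross (begin
  (p *ₚ s +ₚ r *ₚ q) *ₚ (q′ *ₚ s′)
    ≈⟨ solve 6 (λ p q r s q′ s′ → (p :* s :+ r :* q) :* (q′ :* s′)
                               := p :* q′ :* (s :* s′) :+ r :* s′ :* (q :* q′))
         refl p q r s q′ s′ ⟩
  p *ₚ q′ *ₚ (s *ₚ s′) +ₚ r *ₚ s′ *ₚ (q *ₚ q′)
    ≈⟨ +ₚ-cong (*ₚ-congʳ (s *ₚ s′) (cross-≈ f≈g)) (*ₚ-congʳ (q *ₚ q′) (cross-≈ h≈k)) ⟩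
  p′ *ₚ q *ₚ (s *ₚ s′) +ₚ r′ *ₚ s *ₚ (q *ₚ q′)
    ≈⟨ solve 6 (λ p′ q r′ s q′ s′ → p′ :* q :* (s :* s′) :+ r′ :* s :* (q :* q′)
                                 := (p′ :* s′ :+ r′ :* q′) :* (q :* s))
         refl p′ q r′ s q′ s′ ⟩
  (p′ *ₚ s′ +ₚ r′ *ₚ q′) *ₚ (q *ₚ s) ∎)

*-cong : ∀ {f g h k} → f ≈ g → h ≈ k → f * h ≈ g * k
*-cong {p / q ⟨ _ ⟩} {p′ / q′ ⟨ _ ⟩} {r / s ⟨ _ ⟩} {r′ / s′ ⟨ _ ⟩} f≈g h≈k = cross (begin
  p *ₚ r *ₚ (q′ *ₚ s′)     ≈⟨ solve 4 (λ p r q s → p :* r :* (q :* s) := p :* q :* (r :* s)) refl p r q′ s′ ⟩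
  p *ₚ q′ *ₚ (r *ₚ s′)     ≈⟨ *ₚ-cong (cross-≈ f≈g) (cross-≈ h≈k) ⟩
  p′ *ₚ q *ₚ (r′ *ₚ s)     ≈⟨ solve 4 (λ p r q s → p :* q :* (r :* s) := p :* r :* (q :* s)) refl p′ r′ q s ⟩
  p′ *ₚ r′ *ₚ (q *ₚ s)     ∎)

neg-cong : ∀ {f g} → f ≈ g → - f ≈ - g
neg-cong {p / q ⟨ _ ⟩} {r / s ⟨ _ ⟩} f≈g = cross (begin
  (-ₚ p) *ₚ s   ≈⟨ solve 2 (λ p s → (:- p) :* s := :- (p :* s)) refl p s ⟩
  -ₚ (p *ₚ s)   ≈⟨ -‿cong (cross-≈ f≈g) ⟩
  -ₚ (r *ₚ q)   ≈⟨ solve 2 (λ r q → :- (r :* q) := (:- r) :* q) refl r q ⟩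
  (-ₚ r) *ₚ q   ∎)

+-assoc : ∀ f g h → (f + g) + h ≈ f + (g + h)
+-assoc (p / q ⟨ _ ⟩) (r / s ⟨ _ ⟩) (t / u ⟨ _ ⟩) = cross
  (solve 6 (λ p q r s t u →
      ((p :* s :+ r :* q) :* u :+ t :* (q :* s)) :* (q :* (s :* u))
   := (p :* (s :* u) :+ (r :* u :+ t :* s) :* q) :* (q :* s :* u))
    refl p q r s t u)

+-comm : ∀ f g → f + g ≈ g + f
+-comm (p / q ⟨ _ ⟩) (r / s ⟨ _ ⟩) = cross
  (solve 4 (λ p q r s → (p :* s :+ r :* q) :* (s :* q) := (r :* q :+ p :* s) :* (q :* s))
    refl p q r s)

+-identityˡ : ∀ f → 0# + f ≈ f
+-identityˡ (p / q ⟨ _ ⟩) = cross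
  (solve 2 (λ p q → p :* con 1ℚ :* q := p :* (con 1ℚ :* q)) refl p q)

*-assoc : ∀ f g h → (f * g) * h ≈ f * (g * h)
*-assoc (p / q ⟨ _ ⟩) (r / s ⟨ _ ⟩) (t / u ⟨ _ ⟩) = cross
  (solve 6 (λ p q r s t u → p :* r :* t :* (q :* (s :* u)) := p :* (r :* t) :* (q :* s :* u))
    refl p q r s t u)

*-comm : ∀ f g → f * g ≈ g * f
*-comm (p / q ⟨ _ ⟩) (r / s ⟨ _ ⟩) = cross
  (solve 4 (λ p q r s → p :* r :* (s :* q) := r :* p :* (q :* s)) refl p q r s)

*-identityˡ : ∀ f → 1# * f ≈ f
*-identityˡ (p / q ⟨ _ ⟩) = cross
  (solve 2 (λ p q → con 1ℚ :* p :* q := p :* (con 1ℚ :* q)) refl p q)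

-- Finite sums and products of rational functions

+-0-commutativeMonoid : CommutativeMonoid 0ℓ 0ℓ
+-0-commutativeMonoid = record
  { _∙_ = _+_
  ; ε   = 0#
  ; isCommutativeMonoid = isCommutativeMonoidˡ record
    { isSemigroup = record
      { isMagma = record { isEquivalence = ≈-isEquivalence ; ∙-cong = +-cong }
      ; assoc = +-assoc
      }
    ; identityˡ = +-identityˡ
    ; comm = +-comm
    }
  }

*-1-commutativeMonoid : CommutativeMonoid 0ℓ 0ℓ
*-1-commutativeMonoid = record
  { _∙_ = _*_
  ; ε   = 1#
  ; isCommutativeMonoid = isCommutativeMonoidˡ record
    { isSemigroup = record
      { isMagma = record { isEquivalence = ≈-isEquivalence ; ∙-cong = *-cong }
      ; assoc = *-assoc
      }
    ; identityˡ = *-identityˡ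
    ; comm = *-comm
    }
  }

module _ {c ℓ} (M : Monoid c ℓ) where
  private module M = Monoid M
  open MonoidSum M using (sum-init-last; sum-cong-≗) renaming (sum to sumᴹ)

  -- `sum` unfolds at its first term, but telescoping adds the last one. Stating this for any monoid
  -- serves sums and products alike.
  sum-∷ʳ : ∀ n (f : ℕ → M.Carrier) →
    sumᴹ {suc n} (f ∘ toℕ) M.≈ sumᴹ {n} (f ∘ toℕ) M.∙ f n
  sum-∷ʳ n f = M.trans (sum-init-last {n} (f ∘ toℕ))
    (M.∙-cong (M.reflexive (sum-cong-≗ {n} (cong f ∘ toℕ-inject₁)))
              (M.reflexive (cong f (toℕ-fromℕ n))))

∑-suc : ∀ n f → sum {suc n} (f ∘ toℕ) ≈ sum {n} (f ∘ toℕ) + f n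
∑-suc = sum-∷ʳ (CommutativeMonoid.monoid +-0-commutativeMonoid)

∏-suc : ∀ n f → product {suc n} (f ∘ toℕ) ≈ product {n} (f ∘ toℕ) * f n
∏-suc = sum-∷ʳ (CommutativeMonoid.monoid *-1-commutativeMonoid)

-- Closed forms of the product and the sum, and the identity

module _ (e : ℕ) where
  private
    b : ℕ
    b = suc (suc e)

  _/U₋₁ : ℚ[x] → ℕ → ℚ⟨x⟩
  (p /U₋₁) n = p / U₋₁ (b ℕ.^ n) ⟨ U₋₁-power≉0 e n ⟩

  -- Each new factor `1 / (U_d ∘ T_m)` with `m = b^n` turns the denominator `U₋₁ m` into
  -- `U₋₁ (b ℕ.* m)`. The empty product matches because `U₋₁ 1 = U_0 = 1`.
  ∏-closed : ∀ n → product {n} (λ j → 1/U∘T (suc e) (b ℕ.^ toℕ j)) ≈ (1ₚ /U₋₁) n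
  ∏-closed zero    = cross refl
  ∏-closed (suc n) = ≈.trans (∏-suc n (λ j → 1/U∘T (suc e) (b ℕ.^ j)))
    (≈.trans (*-cong (∏-closed n) (≈.refl {1/U∘T (suc e) m})) (cross (begin
      1ₚ *ₚ 1ₚ *ₚ U₋₁ (b ℕ.* m)       ≈⟨ *ₚ-identityˡ (U₋₁ (b ℕ.* m)) ⟩
      U₋₁ (b ℕ.* m)                   ≈⟨ U₋₁-multiple e m ⟩
      U₋₁ m *ₚ (U (suc e) ∘ₚ T m)     ≈⟨ *ₚ-identityˡ _ ⟨
      1ₚ *ₚ (U₋₁ m *ₚ (U (suc e) ∘ₚ T m)) ∎)))
    where m = b ℕ.^ n

  ∑-closed : ∀ n →
    sum {n} (λ k → fromPoly (U e ∘ₚ T (b ℕ.^ toℕ k))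
                   * (∏[ j ≤ toℕ k ] 1/U∘T (suc e) (b ℕ.^ j)))
      ≈ (U₋₂ (b ℕ.^ n) /U₋₁) n
  ∑-closed zero    = cross refl
  ∑-closed (suc n) = ≈.trans
    (∑-suc n (λ k → fromPoly (U e ∘ₚ T (b ℕ.^ k)) * (∏[ j ≤ k ] 1/U∘T (suc e) (b ℕ.^ j))))
    -- The product inside the summand of index `n` runs over `j ≤ n`, hence has `n + 1` factors.
    (≈.trans (+-cong (∑-closed n) (*-cong (≈.refl {fromPoly E}) (∏-closed (suc n)))) (cross (begin
      (w *ₚ (1ₚ *ₚ v′) +ₚ E *ₚ 1ₚ *ₚ v) *ₚ v′
        ≈⟨ *ₚ-congʳ v′ (+ₚ-congʳ (*ₚ-congˡ w (*ₚ-congˡ 1ₚ (U₋₁-multiple e m)))) ⟩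
      (w *ₚ (1ₚ *ₚ (v *ₚ D)) +ₚ E *ₚ 1ₚ *ₚ v) *ₚ v′
        ≈⟨ solve 5 (λ w v v′ D E → (w :* (con 1ℚ :* (v :* D)) :+ E :* con 1ℚ :* v) :* v′
                                := (w :* D :+ E) :* (v :* (con 1ℚ :* v′)))
             refl w v v′ D E ⟩
      (w *ₚ D +ₚ E) *ₚ (v *ₚ (1ₚ *ₚ v′))
        ≈⟨ *ₚ-congʳ (v *ₚ (1ₚ *ₚ v′)) (U₋₂-multiple e m) ⟨
      U₋₂ (b ℕ.* m) *ₚ (v *ₚ (1ₚ *ₚ v′)) ∎)))
    where
    m  = b ℕ.^ n
    v  = U₋₁ m
    w  = U₋₂ m
    v′ = U₋₁ (b ℕ.* m)
    D  = U (suc e) ∘ₚ T m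
    E  = U e ∘ₚ T m

  closed-identity : ∀ n → let s = (U₋₂ (b ℕ.^ n) /U₋₁) n in
    s ^ 2 - fromPoly 2X * s + 1# ≈ (1ₚ /U₋₁) n ^ 2
  closed-identity n = cross (begin
    ((w *ₚ (w *ₚ 1ₚ) *ₚ (1ₚ *ₚ v) +ₚ (-ₚ (2X *ₚ w)) *ₚ vv) *ₚ 1ₚ +ₚ 1ₚ *ₚ (vv *ₚ (1ₚ *ₚ v))) *ₚ vv
      -- The unreduced denominators leave a common factor `v³`; apart from it the left side is the
      -- quadratic form of `U₋₂-U₋₁-norm` and the right side is 1.
      ≈⟨ solve 3 (λ x v w → let vv = v :* (v :* con 1ℚ) in
           ((w :* (w :* con 1ℚ) :* (con 1ℚ :* v) :+ (:- (x :* w)) :* vv) :* con 1ℚ :+ con 1ℚ :* (vv :* (con 1ℚ :* v))) :* vv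
           := (w :* w :- x :* (w :* v) :+ v :* v) :* (v :* v :* v)) refl 2X v w ⟩
    (w *ₚ w -ₚ 2X *ₚ (w *ₚ v) +ₚ v *ₚ v) *ₚ (v *ₚ v *ₚ v)
      ≈⟨ *ₚ-congʳ (v *ₚ v *ₚ v) (U₋₂-U₋₁-norm (b ℕ.^ n)) ⟩
    1ₚ *ₚ (v *ₚ v *ₚ v)
      ≈⟨ solve 1 (λ v → let vv = v :* (v :* con 1ℚ) in
           con 1ℚ :* (v :* v :* v)
           := (con 1ℚ :* (con 1ℚ :* con 1ℚ)) :* (vv :* (con 1ℚ :* v) :* con 1ℚ)) refl v ⟩
    (1ₚ *ₚ (1ₚ *ₚ 1ₚ)) *ₚ (vv *ₚ (1ₚ *ₚ v) *ₚ 1ₚ) ∎)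
    where
    v  = U₋₁ (b ℕ.^ n)
    w  = U₋₂ (b ℕ.^ n)
    vv = v *ₚ (v *ₚ 1ₚ)

  -- The base `c` is kept separate from `b` because `d ℕ.+ 1` does not reduce to `suc (suc e)`;
  -- matching on the equation replaces it everywhere at once.
  identity : ∀ n c → c ≡ b →
    let s = ∑[ k ≤ n ] (fromPoly (U e ∘ₚ T (c ℕ.^ k)) * (∏[ j ≤ k ] 1/U∘T (suc e) (c ℕ.^ j))) in
    s ^ 2 - fromPoly 2X * s + 1# ≈ (∏[ j ≤ n ] 1/U∘T (suc e) (c ℕ.^ j)) ^ 2
  identity n c ≡.refl = ≈.trans
    (+-cong (+-cong (square S≈) (neg-cong (*-cong (≈.refl {fromPoly 2X}) S≈))) (≈.refl {1#}))
    (≈.trans (closed-identity (suc n)) (≈.sym (square (∏-closed (suc n)))))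
    where
    S≈ = ∑-closed (suc n)
    square : ∀ {f g} → f ≈ g → f ^ 2 ≈ g ^ 2
    square f≈g = *-cong f≈g (*-cong f≈g (≈.refl {1#}))

theorem1p1 : ∀ (n d : ℕ) → d ≥ 1 →
    S n d ^ 2 - fromPoly 2X * S n d + 1# ≈ (∏[ j ≤ n ] 1/U∘T d ((d ℕ.+ 1) ℕ.^ j)) ^ 2
-- The bound forces `d = suc e`, and then `U (d ∸ 1)` reduces to `U e`.
theorem1p1 n (suc e) (s≤s _) = identity e n (suc e ℕ.+ 1) (ℕ.+-comm (suc e) 1)
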